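{- For $m,n\ge1$ let $p(m,n)$ be the number of Fibonacci polyominoes with horizontal semiperimeter $m$ and vertical semiperimeter $n$, and let $P(x,y)=\sum_{m,n\geq 1}p(m,n)x^my^n$. For $n\geq 2$, \[ [y^n]P(x,y)=(1+x)x\sum_{k=0}^{n-2}C_{k+1}\binom{n-2}{k}x^k, \] and $[y]P(x,y)=x$, where $C_k=\frac{1}{k+1}\binom{2k}{k}$ is the $k$th Catalan number.
   Context: A Fibonacci polyomino is a (nonempty) polyomino, considered up to translation, that is column-convex (each column is a contiguous segment of unit cells) and such that, reading columns from left to right, the bottom cell of each column lies exactly one unit above the bottom cell of the preceding column. Equivalently, it is given by a sequence of column heights $(h_1,\dots,h_m)$, $m\ge 1$, with $h_i\ge 2$ for $1\le i\le m-1$ and $h_m\ge 1$; column $i$ consists of the cells in column position $i$ and rows $i,i+1,\dots,i+h_i-1$. The horizontal (resp. vertical) semiperimeter of a polyomino is half the number of horizontal (resp. vertical) unit edges on its boundary (a boundary edge is a unit edge belonging to exactly one cell). $[y^n]P(x,y)$ denotes the coefficient of $y^n$, as a power series in $x$. -}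

module Defs where

open import Data.Fin using (Fin)
open import Data.List using (List; []; _∷_; _++_; [_]; map; concatMap; filter; length; upTo)
open import Data.List.Membership.DecPropositional using (_∈?_)
open import Data.Nat using (ℕ; zero; suc; _+_; _*_; _∸_; _≥_; _/_; _≟_)
open import Data.Nat.Combinatorics using (_C_)
open import Data.Product using (Σ-syntax; _×_; _,_)
open import Data.Product.Properties using (≡-dec)
open import Function.Bundles using (_↔_)
open import Relation.Binary.Definitions using (DecidableEquality)
open import Relation.Binary.PropositionalEquality using (_≡_)

-- The cell (i , j) is the unit square [i, i+1] × [j, j+1].
Cell : Set
Cell = ℕ × ℕ

-- A unit edge is named by its left end (horizontal edges) or its lower end
-- (vertical edges).
Edge : Set
Edge = ℕ × ℕ

_≟ₑ_ : DecidableEquality Edge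
_≟ₑ_ = ≡-dec _≟_ _≟_

horizontalEdges : Cell → List Edge
horizontalEdges (i , j) = (i , j) ∷ (i , suc j) ∷ []

verticalEdges : Cell → List Edge
verticalEdges (i , j) = (i , j) ∷ (suc i , j) ∷ []

cellsContaining : (Cell → List Edge) → List Cell → Edge → List Cell
cellsContaining edges cs e = filter (λ c → _∈?_ _≟ₑ_ e (edges c)) cs

-- No edge is listed twice: an edge belonging to exactly one of the (distinct)
-- cells occurs exactly once in concatMap edges cs.
boundaryEdges : (Cell → List Edge) → List Cell → List Edge
boundaryEdges edges cs =
  filter (λ e → length (cellsContaining edges cs e) ≟ 1) (concatMap edges cs)

data IsFibonacci : List ℕ → Set where
  last : ∀ {h} → h ≥ 1 → IsFibonacci [ h ]
  _∷_  : ∀ {h hs} → h ≥ 2 → IsFibonacci hs → IsFibonacci (h ∷ hs)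

-- A translation class of polyominoes, given by its column heights from left to
-- right; its representative has lower left cell (1 , 1).
record FibonacciPolyomino : Set where
  constructor polyomino
  field
    heights     : List ℕ
    isFibonacci : IsFibonacci heights

open FibonacciPolyomino public

columnCells : ℕ → ℕ → List Cell
columnCells i h = map (λ j → (i , i + j)) (upTo h)

cellsFrom : ℕ → List ℕ → List Cell
cellsFrom i []       = []
cellsFrom i (h ∷ hs) = columnCells i h ++ cellsFrom (suc i) hs

cells : FibonacciPolyomino → List Cell
cells π = cellsFrom 1 (heights π)

HasHorizontalSemiperimeter : FibonacciPolyomino → ℕ → Set
HasHorizontalSemiperimeter π m = length (boundaryEdges horizontalEdges (cells π)) ≡ 2 * m

HasVerticalSemiperimeter : FibonacciPolyomino → ℕ → Set
HasVerticalSemiperimeter π n = length (boundaryEdges verticalEdges (cells π)) ≡ 2 * n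

FibonacciPolyominoes : ℕ → ℕ → Set
FibonacciPolyominoes m n =
  Σ[ π ∈ FibonacciPolyomino ] HasHorizontalSemiperimeter π m × HasVerticalSemiperimeter π n

-- This determines p m n for all m , n ≥ 1.
CountsFibonacciPolyominoes : (ℕ → ℕ → ℕ) → Set
CountsFibonacciPolyominoes p =
  ∀ m n → m ≥ 1 → n ≥ 1 → FibonacciPolyominoes m n ↔ Fin (p m n)

-- Formal power series in x with coefficients in ℕ: f m is the coefficient of xᵐ.
PowerSeries : Set
PowerSeries = ℕ → ℕ

infix  4 _≈ₚ_
infixl 6 _+ₚ_
infixl 7 _*ₚ_ _·ₚ_
infixr 8 _^ₚ_

_≈ₚ_ : PowerSeries → PowerSeries → Set
f ≈ₚ g = ∀ m → f m ≡ g m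

∑[0⋯_] : ℕ → (ℕ → ℕ) → ℕ
∑[0⋯ zero  ] a = a 0
∑[0⋯ suc n ] a = ∑[0⋯ n ] a + a (suc n)

1ₚ x : PowerSeries
1ₚ zero    = 1
1ₚ (suc _) = 0

x 1 = 1
x _ = 0

_+ₚ_ _*ₚ_ : PowerSeries → PowerSeries → PowerSeries
(f +ₚ g) m = f m + g m
(f *ₚ g) m = ∑[0⋯ m ] λ i → f i * g (m ∸ i)

_·ₚ_ : ℕ → PowerSeries → PowerSeries
(c ·ₚ f) m = c * f m

_^ₚ_ : PowerSeries → ℕ → PowerSeries
f ^ₚ zero  = 1ₚ
f ^ₚ suc k = f *ₚ f ^ₚ k

∑ₚ[0⋯_] : ℕ → (ℕ → PowerSeries) → PowerSeries
∑ₚ[0⋯ n ] F m = ∑[0⋯ n ] λ k → F k m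

-- Formal power series in x and y: F m n is the coefficient of xᵐyⁿ.
PowerSeries₂ : Set
PowerSeries₂ = ℕ → ℕ → ℕ

[y^_]_ : ℕ → PowerSeries₂ → PowerSeries
([y^ n ] F) m = F m n

-- ∑_{m,n≥1} p(m,n) xᵐyⁿ
generatingFunction : (ℕ → ℕ → ℕ) → PowerSeries₂
generatingFunction p zero    _       = 0
generatingFunction p (suc _) zero    = 0
generatingFunction p (suc m) (suc n) = p (suc m) (suc n)

-- The division is exact.
catalan : ℕ → ℕ
catalan k = ((2 * k) C k) / suc k

{-# OPTIONS --safe #-}

-- The horizontal semiperimeter is the number of columns, and the vertical one
-- is h₁ + ∑ (hᵢ₊₁ + 1 ∸ hᵢ), the total ascent of the upper boundary.  A last
-- column of height 1 adds nothing to that ascent; removing it accounts for the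
-- factor 1 + x, and leaves sequences with all hᵢ = vᵢ + 2.  Let F m u be the
-- generating function, in y, of the ascents of m such columns placed after a
-- column with v = u (the first column follows a fictitious u = 0, which costs
-- one factor y).  With w = y / (1 - y), prepending a column sends the basis
-- element u C k to ∑_{j ≤ k+1} w^(k+1-j) (u C j), the rule of the Catalan
-- generating tree, so F m u = ∑_{k+i=m} ballot k i (u C k) wⁱ.  At u = 0 only
-- catalan m · wᵐ survives.
module Submission where

open import Defs
open import Data.Bool using (if_then_else_; true; false)
open import Data.Fin using (Fin)
open import Data.Fin.Properties using (+↔⊎; 1↔⊤)
open import Data.List using (List; []; _∷_; _++_; [_]; concatMap; filter; length; applyUpTo)
open import Data.List.Membership.DecPropositional using (_∈?_)
open import Data.List.Membership.Propositional using (_∈_)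
open import Data.List.Properties using (length-++; filter-++; concatMap-++; map-upTo)
open import Data.List.Relation.Unary.All using (All; []; _∷_)
open import Data.List.Relation.Unary.Any using (here; there)
open import Data.Nat using (ℕ; zero; suc; pred; _+_; _*_; _∸_; _/_; _≤_; _<_; _≥_; z≤n; s≤s; _≟_; _≤?_)
open import Data.Nat.Combinatorics using (_C_; nCk≡nC[n∸k]; nC1≡n; nCn≡1; k>n⇒nCk≡0; nCk+nC[k+1]≡[n+1]C[k+1])
open import Data.Nat.DivMod using (m*n/n≡m)
open import Data.Nat.Properties hiding (_≟_; _≤?_)
open import Data.Nat.Solver using (module +-*-Solver)
open import Data.Product using (Σ; Σ-syntax; _×_; _,_; proj₁; proj₂)
open import Data.Product.Function.Dependent.Propositional using () renaming (congˡ to Σ-congˡ)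
open import Data.Sum using (_⊎_; inj₁; inj₂)
open import Data.Sum.Function.Propositional using (_⊎-↔_)
open import Data.Unit using (⊤; tt)
open import Data.Vec using (Vec; []; _∷_)
open import Function using (_∘_)
open import Function.Bundles using (_↔_; mk↔ₛ′)
open import Function.Properties.Inverse using (↔-sym; ↔-trans)
open import Function.Related.Propositional using (bijection)
open import Relation.Binary.PropositionalEquality using (_≡_; _≢_; refl; sym; trans; cong; cong₂; module ≡-Reasoning)
open import Relation.Nullary using (Dec; yes; no; does; contradiction; ¬_)
open import Relation.Nullary.Decidable using (dec-true; dec-false)
open ≡-Reasoning
open +-*-Solver
open import Algebra.Properties.CommutativeSemigroup +-commutativeSemigroup using (interchange)

-- Binomial coefficients

0C[1+k]≡0 : ∀ k → 0 C suc k ≡ 0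
0C[1+k]≡0 k = k>n⇒nCk≡0 {0} {suc k} (s≤s z≤n)

nC0≡1 : ∀ n → n C 0 ≡ 1
nC0≡1 n = trans (nCk≡nC[n∸k] {0} {n} z≤n) (nCn≡1 n)

pascal : ∀ n k → suc n C suc k ≡ n C k + n C suc k
pascal n k = sym (nCk+nC[k+1]≡[n+1]C[k+1] n k)

-- This is `(k + 1) (n C (k + 1)) = (n - k) (n C k)` with the subtraction moved across, so that
-- `k > n` needs no separate treatment. Pascal's rule reduces row `n + 1` to two instances in row
-- `n`.
absorption : ∀ n k → suc k * (n C suc k) + k * (n C k) ≡ n * (n C k)
absorption zero zero = refl
absorption zero (suc k)
  rewrite 0C[1+k]≡0 k | 0C[1+k]≡0 (suc k) | *-zeroʳ k = refl
absorption (suc n) zero rewrite nC1≡n (suc n) | nC0≡1 (suc n) =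
  solve 1 (λ n → con 1 :* (con 1 :+ n) :+ con 0 := (con 1 :+ n) :* con 1) refl n
absorption (suc n) (suc k)
  rewrite pascal n k | pascal n (suc k) = begin
  (2 + k) * (b + c) + (1 + k) * (a + b)
    ≡⟨ solve 4 (λ k a b c → (con 2 :+ k) :* (b :+ c) :+ (con 1 :+ k) :* (a :+ b)
         := ((con 2 :+ k) :* c :+ (con 1 :+ k) :* b) :+ ((con 1 :+ k) :* b :+ k :* a) :+ (a :+ b))
         refl k a b c ⟩
  ((2 + k) * c + (1 + k) * b) + ((1 + k) * b + k * a) + (a + b)
    ≡⟨ cong (_+ (a + b)) (cong₂ _+_ (absorption n (suc k)) (absorption n k)) ⟩
  n * b + n * a + (a + b)
    ≡⟨ solve 3 (λ n a b → n :* b :+ n :* a :+ (a :+ b) := (con 1 :+ n) :* (a :+ b)) refl n a b ⟩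
  suc n * (a + b) ∎
  where
  a = n C k
  b = n C suc k
  c = n C suc (suc k)

-- Ballot and Catalan numbers

-- Lattice paths with `k + i` up steps and `i` down steps that never go below 0, so ending at height
-- `k`. The recursion removes the last step.
ballot : ℕ → ℕ → ℕ
ballot k       zero    = 1
ballot zero    (suc i) = ballot 1 i
ballot (suc k) (suc i) = ballot k (suc i) + ballot (suc (suc k)) i

-- The reflection principle, written additively to avoid truncated subtraction. Pascal's rule
-- matches the ballot recursion; at `k = 0` only one predecessor exists, and the equality of the two
-- middle binomials in an odd row replaces the other.
ballot-formula : ∀ k i → let n = k + (i + i) in ballot k i + n C suc (k + i) ≡ n C (k + i)
ballot-formula k zero
  rewrite +-identityʳ k | k>n⇒nCk≡0 (n<1+n k) | nCn≡1 k = refl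
ballot-formula zero (suc i) rewrite +-suc i i = begin
  ballot 1 i + suc n C suc (suc i)        ≡⟨ cong (ballot 1 i +_) (pascal n (suc i)) ⟩
  ballot 1 i + (n C suc i + n C suc (suc i)) ≡⟨ solve 3 (λ u v w → u :+ (v :+ w) := (u :+ w) :+ v) refl (ballot 1 i) (n C suc i) (n C suc (suc i)) ⟩
  ballot 1 i + n C suc (suc i) + n C suc i   ≡⟨ cong (_+ n C suc i) (ballot-formula 1 i) ⟩
  n C suc i + n C suc i                      ≡⟨ cong (_+ n C suc i) middle ⟩
  n C i + n C suc i                          ≡⟨ pascal n i ⟨
  suc n C suc i                              ∎
  where
  n = suc (i + i)
  middle : n C suc i ≡ n C i
  middle = trans (nCk≡nC[n∸k] (s≤s (m≤m+n i i))) (cong (n C_) (m+n∸m≡n i i))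
ballot-formula (suc k) (suc i) = begin
  d₁ + d₂ + suc n C suc (suc m)                ≡⟨ cong (d₁ + d₂ +_) (pascal n (suc m)) ⟩
  d₁ + d₂ + (n C suc m + n C suc (suc m))      ≡⟨ interchange d₁ d₂ (n C suc m) (n C suc (suc m)) ⟩
  (d₁ + n C suc m) + (d₂ + n C suc (suc m))    ≡⟨ cong₂ _+_ (ballot-formula k (suc i)) ih₂ ⟩
  n C m + n C suc m                            ≡⟨ pascal n m ⟨
  suc n C suc m ∎
  where
  n = k + (suc i + suc i)
  m = k + suc i
  d₁ = ballot k (suc i)
  d₂ = ballot (suc (suc k)) i
  ih₂ : d₂ + n C suc (suc m) ≡ n C suc m
  ih₂ rewrite +-suc i i | +-suc k (suc (i + i)) | +-suc k (i + i) | +-suc k i = ballot-formula (suc (suc k)) i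

-- Absorption in row `2m` gives `(m + 1) c⁺ = m c`, so `(m + 1) (c - c⁺) = c`. By the reflection
-- formula `c - c⁺` is `ballot 0 m`, hence the division is exact.
ballot-catalan : ∀ m → ballot 0 m ≡ catalan m
ballot-catalan m rewrite +-identityʳ m = begin
  ballot 0 m                     ≡⟨ m*n/n≡m (ballot 0 m) (suc m) ⟨
  (ballot 0 m * suc m) / suc m   ≡⟨ cong (_/ suc m) (+-cancelʳ-≡ (m * c) _ _ eq) ⟩
  c / suc m                      ∎
  where
  c = (m + m) C m
  c⁺ = (m + m) C suc m
  absorbed : suc m * c⁺ ≡ m * c
  absorbed = +-cancelʳ-≡ (m * c) _ _ (trans (absorption (m + m) m) (*-distribʳ-+ c m m))
  eq : ballot 0 m * suc m + m * c ≡ c + m * c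
  eq = begin
    ballot 0 m * suc m + m * c       ≡⟨ cong (ballot 0 m * suc m +_) absorbed ⟨
    ballot 0 m * suc m + suc m * c⁺
      ≡⟨ solve 3 (λ d m c → d :* (con 1 :+ m) :+ (con 1 :+ m) :* c := (con 1 :+ m) :* (d :+ c)) refl
           (ballot 0 m) m c⁺ ⟩
    suc m * (ballot 0 m + c⁺)        ≡⟨ cong (suc m *_) (ballot-formula 0 m) ⟩
    suc m * c                        ∎

-- The coefficient of yᵉ in (y / (1 - y))ⁱ.
compositions : ℕ → ℕ → ℕ
compositions zero    zero    = 1
compositions zero    (suc e) = 0
compositions (suc i) zero    = 0
compositions (suc i) (suc e) = compositions i e + compositions (suc i) e

-- A composition of `e + 1` into `i + 1` positive parts is a choice of `i` among `e` gaps; the two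
-- recursions agree by Pascal's rule.
compositions-binomial : ∀ i e → compositions (suc i) (suc e) ≡ e C i
compositions-binomial zero    zero    = refl
compositions-binomial (suc i) zero    = sym (0C[1+k]≡0 i)
compositions-binomial zero    (suc e) = trans (compositions-binomial zero e) (trans (nC0≡1 e) (sym (nC0≡1 (suc e))))
compositions-binomial (suc i) (suc e) = begin
  compositions (suc i) (suc e) + compositions (suc (suc i)) (suc e)
    ≡⟨ cong₂ _+_ (compositions-binomial i e) (compositions-binomial (suc i) e) ⟩
  e C i + e C suc i ≡⟨ pascal e i ⟨
  suc e C suc i ∎

-- Sums over k + i = m

antidiagonal : ℕ → (ℕ → ℕ → ℕ) → ℕ
antidiagonal zero    f = f 0 0
antidiagonal (suc m) f = f (suc m) 0 + antidiagonal m (λ k i → f k (suc i))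

antidiagonal-cong : ∀ m {f g} → (∀ k i → k + i ≡ m → f k i ≡ g k i) → antidiagonal m f ≡ antidiagonal m g
antidiagonal-cong zero    f≈g = f≈g 0 0 refl
antidiagonal-cong (suc m) f≈g =
  cong₂ _+_ (f≈g (suc m) 0 (+-identityʳ (suc m)))
            (antidiagonal-cong m (λ k i k+i≡m → f≈g k (suc i) (trans (+-suc k i) (cong suc k+i≡m))))

antidiagonal-+ : ∀ m f g → antidiagonal m (λ k i → f k i + g k i) ≡ antidiagonal m f + antidiagonal m g
antidiagonal-+ zero    f g = refl
antidiagonal-+ (suc m) f g
  rewrite antidiagonal-+ m (λ k i → f k (suc i)) (λ k i → g k (suc i)) =
  interchange (f (suc m) 0) (g (suc m) 0) _ _

antidiagonal-0 : ∀ m {f} → (∀ k i → f k i ≡ 0) → antidiagonal m f ≡ 0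
antidiagonal-0 zero    f≈0 = f≈0 0 0
antidiagonal-0 (suc m) f≈0 = cong₂ _+_ (f≈0 (suc m) 0) (antidiagonal-0 m (λ k i → f≈0 k (suc i)))

antidiagonal-last : ∀ m f → (∀ k i → f (suc k) i ≡ 0) → antidiagonal m f ≡ f 0 m
antidiagonal-last zero    f f≈0 = refl
antidiagonal-last (suc m) f f≈0 rewrite f≈0 m 0 = antidiagonal-last m (λ k i → f k (suc i)) (λ k i → f≈0 k (suc i))

antidiagonal-sucˡ : ∀ m f → (∀ i → f 0 i ≡ 0) → antidiagonal (suc m) f ≡ antidiagonal m (λ k i → f (suc k) i)
antidiagonal-sucˡ zero    f f≈0 = trans (cong (f 1 0 +_) (f≈0 1)) (+-identityʳ (f 1 0))
antidiagonal-sucˡ (suc m) f f≈0 = cong (f (suc (suc m)) 0 +_) (antidiagonal-sucˡ m (λ k i → f k (suc i)) (f≈0 ∘ suc))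

shiftˡ shiftʳ : (ℕ → ℕ → ℕ) → ℕ → ℕ → ℕ
shiftˡ f zero    i = 0
shiftˡ f (suc k) i = f k i
shiftʳ f k zero    = 0
shiftʳ f k (suc i) = f k i

-- A pair with sum `suc m` has the predecessors `(k - 1, i)` and `(k, i - 1)`. Sorting the
-- contributions by predecessor leaves two full sums over `m`.
antidiagonal-split : ∀ m f g h → (∀ k i → k + i ≡ suc m → f k i ≡ shiftˡ g k i + shiftʳ h k i) →
  antidiagonal (suc m) f ≡ antidiagonal m g + antidiagonal m h
antidiagonal-split m f g h f≈ = begin
  antidiagonal (suc m) f                                             ≡⟨ antidiagonal-cong (suc m) f≈ ⟩
  antidiagonal (suc m) (λ k i → shiftˡ g k i + shiftʳ h k i)         ≡⟨ antidiagonal-+ (suc m) (shiftˡ g) (shiftʳ h) ⟩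
  -- Only `shiftˡ` needs an argument: the sum of `shiftʳ h` starts with its zero entry and then
  -- computes to the sum of `h`.
  antidiagonal (suc m) (shiftˡ g) + antidiagonal (suc m) (shiftʳ h)  ≡⟨ cong (_+ antidiagonal m h) (antidiagonal-sucˡ m (shiftˡ g) (λ _ → refl)) ⟩
  antidiagonal m g + antidiagonal m h                                ∎

-- Reindexing along one antidiagonal, from `(k, i + 1)` to `(k + 1, i)`. The unmatched entry at
-- either end is zero.
antidiagonal-shift : ∀ m h → (∀ i → h 0 i ≡ 0) → antidiagonal m (shiftʳ (h ∘ suc)) ≡ antidiagonal m h
antidiagonal-shift zero    h h≈0 = sym (h≈0 0)
antidiagonal-shift (suc m) h h≈0 = sym (antidiagonal-sucˡ m h h≈0)

-- Writing w = y / (1 - y), this is the coefficient of yᵉ in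
-- ∑_{k+i=m} ballot k i · (u C k) · wⁱ.
ballotSum : ℕ → ℕ → ℕ → ℕ
ballotSum m u e = antidiagonal m λ k i → ballot k i * (u C k) * compositions i e

-- The halves of `ballotSum (suc m)` according to the last step of the ballot path. As the
-- recurrences below show, `ballotSumˡ` adds up `ballotSum m v` over the free columns `v < u`, while
-- `ballotSumʳ` collects the columns `v ≥ u`, each delayed by its cost `v + 1 - u`.
ballotSumˡ ballotSumʳ : ℕ → ℕ → ℕ → ℕ
ballotSumˡ m u e = antidiagonal m λ k i → ballot k i * (u C suc k) * compositions i e
ballotSumʳ m u e = antidiagonal m λ k i → ballot (suc k) i * (u C k) * compositions (suc i) e

ballotSum-suc : ∀ m u e → ballotSum (suc m) u e ≡ ballotSumˡ m u e + ballotSumʳ m u e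
ballotSum-suc m u e = antidiagonal-split m _ _ _ terms
  where
  terms : ∀ k i → k + i ≡ suc m → ballot k i * (u C k) * compositions i e
    ≡ shiftˡ (λ k i → ballot k i * (u C suc k) * compositions i e) k i
      + shiftʳ (λ k i → ballot (suc k) i * (u C k) * compositions (suc i) e) k i
  -- The pair `(0, 0)` is excluded by `k + i ≡ suc m`.
  terms zero    (suc i) _ = refl
  terms (suc k) zero    _ = sym (+-identityʳ _)
  terms (suc k) (suc i) _ =
    solve 4 (λ a b c w → (a :+ b) :* c :* w := a :* c :* w :+ b :* c :* w) refl
      (ballot k (suc i)) (ballot (suc (suc k)) i) (u C suc k) (compositions (suc i) e)

ballotSumˡ-0 : ∀ m e → ballotSumˡ m 0 e ≡ 0
ballotSumˡ-0 m e = antidiagonal-0 m λ k i →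
  cong (_* compositions i e) (trans (cong (ballot k i *_) (0C[1+k]≡0 k)) (*-zeroʳ (ballot k i)))

-- Pascal's rule in `u`: the column `v = u` becomes free.
ballotSumˡ-suc : ∀ m u e → ballotSumˡ m (suc u) e ≡ ballotSum m u e + ballotSumˡ m u e
ballotSumˡ-suc m u e = trans (antidiagonal-cong m terms) (antidiagonal-+ m _ _)
  where
  terms : ∀ k i → k + i ≡ m → ballot k i * (suc u C suc k) * compositions i e
    ≡ ballot k i * (u C k) * compositions i e + ballot k i * (u C suc k) * compositions i e
  terms k i _ rewrite pascal u k =
    solve 4 (λ a b c w → a :* (b :+ c) :* w := a :* b :* w :+ a :* c :* w) refl
      (ballot k i) (u C k) (u C suc k) (compositions i e)

ballotSumʳ-0 : ∀ m u → ballotSumʳ m u 0 ≡ 0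
ballotSumʳ-0 m u = antidiagonal-0 m λ k i → *-zeroʳ (ballot (suc k) i * (u C k))

-- In generating functions, `R u = y (B u + R (u + 1))`. After expanding by `w = y + y w`, the
-- surplus of `ballot (suc k) i` over `ballot k i` has to match the Pascal increment from `u` to
-- `suc u`.
ballotSumʳ-suc : ∀ m u e → ballotSumʳ m u (suc e) ≡ ballotSum m u e + ballotSumʳ m (suc u) e
ballotSumʳ-suc m u e = begin
  ballotSumʳ m u (suc e)
    ≡⟨ antidiagonal-cong m (λ k i _ → *-distribˡ-+ (ballot (suc k) i * (u C k)) (compositions i e) _) ⟩
  antidiagonal m (λ k i → ballot (suc k) i * (u C k) * compositions i e + ballot (suc k) i * (u C k) * compositions (suc i) e)
    ≡⟨ antidiagonal-+ m _ _ ⟩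
  antidiagonal m (λ k i → ballot (suc k) i * (u C k) * compositions i e) + ballotSumʳ m u e
    ≡⟨ cong (_+ ballotSumʳ m u e) (trans (antidiagonal-cong m left) (antidiagonal-+ m _ _)) ⟩
  ballotSum m u e + antidiagonal m (shiftʳ (carry ∘ suc)) + ballotSumʳ m u e
    ≡⟨ cong (λ s → ballotSum m u e + s + ballotSumʳ m u e) (antidiagonal-shift m carry (λ _ → refl)) ⟩
  ballotSum m u e + antidiagonal m carry + ballotSumʳ m u e
    ≡⟨ +-assoc (ballotSum m u e) _ _ ⟩
  ballotSum m u e + (antidiagonal m carry + ballotSumʳ m u e)
    ≡⟨ cong (ballotSum m u e +_) (trans (antidiagonal-cong m right) (antidiagonal-+ m _ _)) ⟨
  ballotSum m u e + ballotSumʳ m (suc u) e ∎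
  where
  -- The surplus found at `(k, i + 1)` is stored at `(k + 1, i)`, where it is exactly the Pascal
  -- increment.
  carry : ℕ → ℕ → ℕ
  carry zero    i = 0
  carry (suc k) i = ballot (suc (suc k)) i * (u C k) * compositions (suc i) e

  left : ∀ k i → k + i ≡ m → ballot (suc k) i * (u C k) * compositions i e
    ≡ ballot k i * (u C k) * compositions i e + shiftʳ (carry ∘ suc) k i
  left k zero    _ = sym (+-identityʳ _)
  left k (suc i) _ =
    solve 4 (λ a b c w → (a :+ b) :* c :* w := a :* c :* w :+ b :* c :* w) refl
      (ballot k (suc i)) (ballot (suc (suc k)) i) (u C k) (compositions (suc i) e)

  right : ∀ k i → k + i ≡ m → ballot (suc k) i * (suc u C k) * compositions (suc i) e
    ≡ carry k i + ballot (suc k) i * (u C k) * compositions (suc i) e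
  right zero    i _ rewrite nC0≡1 u | nC0≡1 (suc u) = refl
  right (suc k) i _ rewrite pascal u k =
    solve 4 (λ a b c w → a :* (b :+ c) :* w := a :* b :* w :+ a :* c :* w) refl
      (ballot (suc (suc k)) i) (u C k) (u C suc k) (compositions (suc i) e)

-- The sum of `c v (e - (suc v ∸ u))` over all `v` with `suc v ∸ u ≤ e`. Splitting off `v = 0` and
-- shifting `c` lowers `u`, or else uses one unit of `e`, which keeps the sum finite.
prependCount : (ℕ → ℕ → ℕ) → ℕ → ℕ → ℕ
prependCount c zero    zero    = 0
prependCount c zero    (suc e) = c 0 e + prependCount (c ∘ suc) zero e
prependCount c (suc u) e       = c 0 e + prependCount (c ∘ suc) u e

prependCount-cong : ∀ {c c′} → (∀ v e → c v e ≡ c′ v e) → ∀ u e → prependCount c u e ≡ prependCount c′ u e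
prependCount-cong c≈c′ zero    zero    = refl
prependCount-cong c≈c′ zero    (suc e) = cong₂ _+_ (c≈c′ 0 e) (prependCount-cong (c≈c′ ∘ suc) zero e)
prependCount-cong c≈c′ (suc u) e       = cong₂ _+_ (c≈c′ 0 e) (prependCount-cong (c≈c′ ∘ suc) u e)

-- The offset s is needed because prependCount recurses by shifting c.
prependCount-ballotSum : ∀ m s u e → prependCount (λ v → ballotSum m (v + s)) u e + ballotSumˡ m s e ≡ ballotSum (suc m) (u + s) e
prependCount-ballotSum m s zero e = begin
  prependCount (λ v → ballotSum m (v + s)) zero e + ballotSumˡ m s e  ≡⟨ cong (_+ ballotSumˡ m s e) (floor s e) ⟩
  ballotSumʳ m s e + ballotSumˡ m s e                                 ≡⟨ +-comm (ballotSumʳ m s e) _ ⟩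
  ballotSumˡ m s e + ballotSumʳ m s e                                 ≡⟨ ballotSum-suc m s e ⟨
  ballotSum (suc m) s e                                       ∎
  where
  -- At `u = 0` no column is free, and iterating `ballotSumʳ-suc` yields the ascending half alone.
  floor : ∀ s e → prependCount (λ v → ballotSum m (v + s)) zero e ≡ ballotSumʳ m s e
  floor s zero    = sym (ballotSumʳ-0 m s)
  floor s (suc e) = begin
    ballotSum m s e + prependCount (λ v → ballotSum m (suc v + s)) zero e
      ≡⟨ cong (ballotSum m s e +_) (prependCount-cong (λ v e → cong (λ t → ballotSum m t e) (sym (+-suc v s))) zero e) ⟩
    ballotSum m s e + prependCount (λ v → ballotSum m (v + suc s)) zero e
      ≡⟨ cong (ballotSum m s e +_) (floor (suc s) e) ⟩
    ballotSum m s e + ballotSumʳ m (suc s) e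
      ≡⟨ ballotSumʳ-suc m s e ⟨
    ballotSumʳ m s (suc e) ∎
prependCount-ballotSum m s (suc u) e = begin
  ballotSum m s e + prependCount (λ v → ballotSum m (suc v + s)) u e + ballotSumˡ m s e
    ≡⟨ cong (λ t → ballotSum m s e + t + ballotSumˡ m s e) (prependCount-cong (λ v e → cong (λ t → ballotSum m t e) (sym (+-suc v s))) u e) ⟩
  ballotSum m s e + prependCount (λ v → ballotSum m (v + suc s)) u e + ballotSumˡ m s e
    -- The free column `ballotSum m s` is the term by which `ballotSumˡ` grows when the offset
    -- becomes `suc s`.
    ≡⟨ solve 3 (λ a b c → a :+ b :+ c := b :+ (a :+ c)) refl (ballotSum m s e) _ (ballotSumˡ m s e) ⟩
  prependCount (λ v → ballotSum m (v + suc s)) u e + (ballotSum m s e + ballotSumˡ m s e)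
    ≡⟨ cong (prependCount (λ v → ballotSum m (v + suc s)) u e +_) (ballotSumˡ-suc m s e) ⟨
  prependCount (λ v → ballotSum m (v + suc s)) u e + ballotSumˡ m (suc s) e
    ≡⟨ prependCount-ballotSum m (suc s) u e ⟩
  ballotSum (suc m) (u + suc s) e
    ≡⟨ cong (λ t → ballotSum (suc m) t e) (+-suc u s) ⟩
  ballotSum (suc m) (suc u + s) e ∎

-- Coefficients of the series `F m u`: sequences of `m` columns of height at least 2, placed after
-- `u`, with total cost `e`.
seqCount : ℕ → ℕ → ℕ → ℕ
seqCount zero    u e = compositions 0 e
seqCount (suc m) u e = prependCount (seqCount m) u e

seqCount≡ballotSum : ∀ m u e → seqCount m u e ≡ ballotSum m u e
seqCount≡ballotSum zero    u e rewrite nC0≡1 u = sym (*-identityˡ _)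
seqCount≡ballotSum (suc m) u e = begin
  prependCount (seqCount m) u e
    ≡⟨ prependCount-cong (λ v e → trans (seqCount≡ballotSum m v e)
                                        (cong (λ t → ballotSum m t e) (sym (+-identityʳ v)))) u e ⟩
  prependCount (λ v → ballotSum m (v + 0)) u e                ≡⟨ +-identityʳ _ ⟨
  prependCount (λ v → ballotSum m (v + 0)) u e + 0            ≡⟨ cong (prependCount (λ v → ballotSum m (v + 0)) u e +_) (ballotSumˡ-0 m e) ⟨
  prependCount (λ v → ballotSum m (v + 0)) u e + ballotSumˡ m 0 e     ≡⟨ prependCount-ballotSum m 0 u e ⟩
  ballotSum (suc m) (u + 0) e                                 ≡⟨ cong (λ t → ballotSum (suc m) t e) (+-identityʳ u) ⟩
  ballotSum (suc m) u e                                       ∎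

seqCount-0 : ∀ m e → seqCount m 0 e ≡ catalan m * compositions m e
seqCount-0 m e = begin
  seqCount m 0 e                            ≡⟨ seqCount≡ballotSum m 0 e ⟩
  ballotSum m 0 e
    ≡⟨ antidiagonal-last m _ (λ k i → cong (_* compositions i e)
         (trans (cong (ballot (suc k) i *_) (0C[1+k]≡0 k)) (*-zeroʳ (ballot (suc k) i)))) ⟩
  ballot 0 m * 1 * compositions m e         ≡⟨ cong (_* compositions m e) (trans (*-identityʳ _) (ballot-catalan m)) ⟩
  catalan m * compositions m e              ∎

-- Counting height sequences

≡↔≡ : {a b c d : ℕ} → (a ≡ b → c ≡ d) → (c ≡ d → a ≡ b) → (a ≡ b) ↔ (c ≡ d)
≡↔≡ to from = mk↔ₛ′ to from (λ _ → ≡-irrelevant _ _) (λ _ → ≡-irrelevant _ _)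

≡-congˡ : {a b c : ℕ} → a ≡ b → (a ≡ c) ↔ (b ≡ c)
≡-congˡ a≡b = ≡↔≡ (trans (sym a≡b)) (trans a≡b)

Σ-congʳ : {X : Set} {P Q : X → Set} → (∀ t → P t ↔ Q t) → Σ X P ↔ Σ X Q
Σ-congʳ P↔Q = Σ-congˡ {k = bijection} (P↔Q _)

Σℕ↔⊎ : ∀ {P : ℕ → Set} → Σ ℕ P ↔ (P 0 ⊎ Σ ℕ (P ∘ suc))
Σℕ↔⊎ = mk↔ₛ′ (λ { (zero , p) → inj₁ p ; (suc v , p) → inj₂ (v , p) })
  (λ { (inj₁ p) → zero , p ; (inj₂ (v , p)) → suc v , p })
  (λ { (inj₁ _) → refl ; (inj₂ _) → refl }) (λ { (zero , _) → refl ; (suc _ , _) → refl })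

⊎↔Fin : ∀ {A B : Set} {a b} → A ↔ Fin a → B ↔ Fin b → (A ⊎ B) ↔ Fin (a + b)
⊎↔Fin A↔ B↔ = ↔-trans (A↔ ⊎-↔ B↔) (↔-sym +↔⊎)

empty↔Fin : ∀ {A : Set} → ¬ A → A ↔ Fin 0
empty↔Fin ¬a = mk↔ₛ′ (λ a → contradiction a ¬a) (λ ()) (λ ()) (λ a → contradiction a ¬a)

singleton↔Fin : ∀ {A : Set} (a : A) → (∀ b → a ≡ b) → A ↔ Fin 1
singleton↔Fin a a≡ = ↔-trans (mk↔ₛ′ (λ _ → tt) (λ _ → a) (λ _ → refl) a≡) (↔-sym 1↔⊤)

0≡e↔Fin : ∀ e → (0 ≡ e) ↔ Fin (compositions 0 e)
0≡e↔Fin zero    = singleton↔Fin refl (≡-irrelevant refl)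
0≡e↔Fin (suc e) = empty↔Fin λ ()

-- The bijective reading of `prependCount`. The family `X`, its cost `κ` and the count `c` are
-- arbitrary so that the induction can shift all three past `v = 0`.
prepend↔Fin : ∀ {X : ℕ → Set} (κ : ∀ v → X v → ℕ) (c : ℕ → ℕ → ℕ) →
  (∀ v e → (Σ[ t ∈ X v ] κ v t ≡ e) ↔ Fin (c v e)) →
  ∀ u e → (Σ[ v ∈ ℕ ] Σ[ t ∈ X v ] (suc v ∸ u) + κ v t ≡ e) ↔ Fin (prependCount c u e)
prepend↔Fin κ c κ↔c zero zero = empty↔Fin λ ()
prepend↔Fin κ c κ↔c zero (suc e) = ↔-trans Σℕ↔⊎
  (⊎↔Fin (↔-trans (Σ-congʳ λ _ → ≡↔≡ suc-injective (cong suc)) (κ↔c 0 e))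
         (↔-trans (Σ-congʳ λ _ → Σ-congʳ λ _ → ≡↔≡ suc-injective (cong suc))
                  (prepend↔Fin (κ ∘ suc) (c ∘ suc) (κ↔c ∘ suc) zero e)))
prepend↔Fin κ c κ↔c (suc u) e = ↔-trans Σℕ↔⊎
  (⊎↔Fin (↔-trans (Σ-congʳ λ t → ≡-congˡ (cong (_+ κ 0 t) (0∸n≡0 u))) (κ↔c 0 e))
         (prepend↔Fin (κ ∘ suc) (c ∘ suc) (κ↔c ∘ suc) u e))

-- (v₁ ∷ … ∷ vₘ , l) stands for the heights v₁ + 2, …, vₘ + 2, l + 1.
Code : ℕ → Set
Code m = Vec ℕ m × ℕ

-- After a column of height `u + 2`, a column of height `h` raises the upper boundary by
-- `h + 1 ∸ (u + 2)`.
cost : ∀ {m} → ℕ → Code m → ℕ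
cost u ([]     , l) = l ∸ u
cost u (v ∷ vs , l) = (suc v ∸ u) + cost v (vs , l)

-- The first argument counts the columns before the last. The last one has height 1 and is free, or
-- is an ordinary column of height at least 2.
fibCount : ℕ → ℕ → ℕ → ℕ
fibCount zero    u e = compositions 0 e + prependCount (λ _ → compositions 0) u e
fibCount (suc m) u e = prependCount (fibCount m) u e

prependCount-+ : ∀ c c′ u e → prependCount (λ v e → c v e + c′ v e) u e ≡ prependCount c u e + prependCount c′ u e
prependCount-+ c c′ zero zero = refl
prependCount-+ c c′ zero (suc e) rewrite prependCount-+ (c ∘ suc) (c′ ∘ suc) zero e =
  interchange (c 0 e) (c′ 0 e) _ _
prependCount-+ c c′ (suc u) e rewrite prependCount-+ (c ∘ suc) (c′ ∘ suc) u e =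
  interchange (c 0 e) (c′ 0 e) _ _

-- Prepending is additive, so the alternative at the last column passes through all earlier ones.
-- This is the source of the factor `1 + x`.
fibCount-split : ∀ m u e → fibCount m u e ≡ seqCount m u e + seqCount (suc m) u e
fibCount-split zero    u e = refl
fibCount-split (suc m) u e = trans (prependCount-cong (fibCount-split m) u e) (prependCount-+ (seqCount m) (seqCount (suc m)) u e)

cost↔Fin : ∀ m u e → (Σ[ w ∈ Code m ] cost u w ≡ e) ↔ Fin (fibCount m u e)
cost↔Fin zero u e = ↔-trans uncode (↔-trans Σℕ↔⊎
  -- `l = 0` is the free last column; `l = suc v` is an ordinary column followed by an empty rest
  -- (`⊤`) of cost 0.
  (⊎↔Fin (↔-trans (≡-congˡ (0∸n≡0 u)) (0≡e↔Fin e))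
         (↔-trans (Σ-congʳ λ v → ↔-trans (≡-congˡ (sym (+-identityʳ (suc v ∸ u)))) ⊤-×)
                  (prepend↔Fin {λ _ → ⊤} (λ _ _ → 0) (λ _ → compositions 0)
                               (λ _ e → ↔-trans (↔-sym ⊤-×) (0≡e↔Fin e)) u e))))
  where
  uncode : (Σ[ w ∈ Code 0 ] cost u w ≡ e) ↔ (Σ[ l ∈ ℕ ] l ∸ u ≡ e)
  uncode = mk↔ₛ′ (λ { (([] , l) , p) → l , p }) (λ (l , p) → ([] , l) , p)
    (λ _ → refl) (λ { (([] , l) , p) → refl })
  ⊤-× : {A : Set} → A ↔ (⊤ × A)
  ⊤-× = mk↔ₛ′ (tt ,_) proj₂ (λ _ → refl) (λ _ → refl)
cost↔Fin (suc m) u e = ↔-trans uncode (prepend↔Fin (λ v → cost v) (fibCount m) (cost↔Fin m) u e)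
  where
  uncode : (Σ[ w ∈ Code (suc m) ] cost u w ≡ e) ↔ (Σ[ v ∈ ℕ ] Σ[ w ∈ Code m ] (suc v ∸ u) + cost v w ≡ e)
  uncode = mk↔ₛ′ (λ { ((v ∷ vs , l) , p) → v , (vs , l) , p }) (λ { (v , (vs , l) , p) → (v ∷ vs , l) , p })
    (λ _ → refl) (λ { ((v ∷ vs , l) , p) → refl })

-- Edge multiplicities and the two semiperimeters

indicator : ∀ {A : Set} → Dec A → ℕ
indicator A? = if does A? then 1 else 0

indicator-yes : ∀ {A : Set} (A? : Dec A) → A → indicator A? ≡ 1
indicator-yes A? a rewrite dec-true A? a = refl

indicator-no : ∀ {A : Set} (A? : Dec A) → ¬ A → indicator A? ≡ 0
indicator-no A? ¬a rewrite dec-false A? ¬a = refl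

∑< : ℕ → (ℕ → ℕ) → ℕ
∑< zero    f = 0
∑< (suc n) f = f 0 + ∑< n (f ∘ suc)

∑<-cong : ∀ n {f g} → (∀ j → j < n → f j ≡ g j) → ∑< n f ≡ ∑< n g
∑<-cong zero    f≈g = refl
∑<-cong (suc n) f≈g = cong₂ _+_ (f≈g 0 (s≤s z≤n)) (∑<-cong n (λ j j<n → f≈g (suc j) (s≤s j<n)))

∑<-+ : ∀ n f g → ∑< n (λ j → f j + g j) ≡ ∑< n f + ∑< n g
∑<-+ zero    f g = refl
∑<-+ (suc n) f g rewrite ∑<-+ n (f ∘ suc) (g ∘ suc) =
  interchange (f 0) (g 0) _ _

∑<-0 : ∀ n → ∑< n (λ _ → 0) ≡ 0
∑<-0 zero    = refl
∑<-0 (suc n) = ∑<-0 n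

below : ℕ → ℕ → ℕ
below t       zero    = 0
below zero    (suc h) = 1
below (suc t) (suc h) = below t h

below-< : ∀ {t h} → t < h → below t h ≡ 1
below-< {zero}  (s≤s _)   = refl
below-< {suc t} (s≤s t<h) = below-< t<h

∑<-δ : ∀ t h → ∑< h (λ j → indicator (t ≟ j)) ≡ below t h
∑<-δ t       zero    = refl
∑<-δ zero    (suc h) = cong suc (∑<-0 h)
∑<-δ (suc t) (suc h) = ∑<-δ t h

-- The `+ 1` stands for a cell of the column and `below j d` for a possible second cell on the same
-- edge; the edge is on the boundary when the latter is absent.
∑<-not-below : ∀ d h → ∑< h (λ j → indicator (below j d + 1 ≟ 1)) ≡ h ∸ d
∑<-not-below d       zero    = sym (0∸n≡0 d)
∑<-not-below zero    (suc h) = cong suc (∑<-not-below zero h)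
∑<-not-below (suc d) (suc h) = ∑<-not-below d h

length-filter-∷ : ∀ {A : Set} {P : A → Set} (P? : ∀ a → Dec (P a)) a as →
  length (filter P? (a ∷ as)) ≡ indicator (P? a) + length (filter P? as)
length-filter-∷ P? a as with does (P? a)
... | true  = refl
... | false = refl

length-filter-++ : ∀ {A : Set} {P : A → Set} (P? : ∀ a → Dec (P a)) as bs →
  length (filter P? (as ++ bs)) ≡ length (filter P? as) + length (filter P? bs)
length-filter-++ P? as bs = trans (cong length (filter-++ P? as bs)) (length-++ (filter P? as))

length-filter-applyUpTo : ∀ {A : Set} {P : A → Set} (P? : ∀ a → Dec (P a)) g h →
  length (filter P? (applyUpTo g h)) ≡ ∑< h (λ j → indicator (P? (g j)))
length-filter-applyUpTo P? g zero    = refl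
length-filter-applyUpTo P? g (suc h) =
  trans (length-filter-∷ P? (g 0) _) (cong (indicator (P? (g 0)) +_) (length-filter-applyUpTo P? (g ∘ suc) h))

length-filter-concatMap : ∀ {A B : Set} {P : B → Set} (P? : ∀ b → Dec (P b)) (f : A → List B) g h →
  length (filter P? (concatMap f (applyUpTo g h))) ≡ ∑< h (λ j → length (filter P? (f (g j))))
length-filter-concatMap P? f g zero    = refl
length-filter-concatMap P? f g (suc h) =
  trans (length-filter-++ P? (f (g 0)) _) (cong (length (filter P? (f (g 0))) +_) (length-filter-concatMap P? f (g ∘ suc) h))

multiplicity : (Cell → List Edge) → List Cell → Edge → ℕ
multiplicity edges cs e = length (cellsContaining edges cs e)

_∈ₑ?_ : (e : Edge) (es : List Edge) → Dec (e ∈ es)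
_∈ₑ?_ = _∈?_ _≟ₑ_

multiplicity-column : ∀ edges i h e →
  multiplicity edges (columnCells i h) e ≡ ∑< h (λ j → indicator (e ∈ₑ? edges (i , i + j)))
multiplicity-column edges i h e = trans
  (cong (λ cs → multiplicity edges cs e) (map-upTo (λ j → i , i + j) h))
  (length-filter-applyUpTo (λ c → e ∈ₑ? edges c) (λ j → i , i + j) h)

multiplicity-∷ : ∀ edges i h hs e →
  multiplicity edges (cellsFrom i (h ∷ hs)) e
    ≡ multiplicity edges (columnCells i h) e + multiplicity edges (cellsFrom (suc i) hs) e
multiplicity-∷ edges i h hs e = length-filter-++ (λ c → e ∈ₑ? edges c) (columnCells i h) _

multiplicity-column-0 : ∀ edges i h e → (∀ j → ¬ e ∈ edges (i , i + j)) → multiplicity edges (columnCells i h) e ≡ 0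
multiplicity-column-0 edges i h e e∉ = begin
  multiplicity edges (columnCells i h) e                   ≡⟨ multiplicity-column edges i h e ⟩
  ∑< h (λ j → indicator (e ∈ₑ? edges (i , i + j)))         ≡⟨ ∑<-cong h (λ j _ → indicator-no (e ∈ₑ? edges (i , i + j)) (e∉ j)) ⟩
  ∑< h (λ _ → 0)                                           ≡⟨ ∑<-0 h ⟩
  0                                                        ∎

indicator-⇔ : ∀ {A B : Set} (A? : Dec A) (B? : Dec B) → (A → B) → (B → A) → indicator A? ≡ indicator B?
indicator-⇔ A? (yes b) to from = indicator-yes A? (from b)
indicator-⇔ A? (no ¬b) to from = indicator-no A? (¬b ∘ to)

-- The multiplicity `μ` is separate from the list because, in an induction over columns, the edges
-- of the remaining columns are still tested against the whole polyomino.
boundarySum : (Cell → List Edge) → (Edge → ℕ) → List Cell → ℕ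
boundarySum edges μ cs = length (filter (λ e → μ e ≟ 1) (concatMap edges cs))

boundarySum-∷ : ∀ edges μ i h hs →
  boundarySum edges μ (cellsFrom i (h ∷ hs))
    ≡ ∑< h (λ j → length (filter (λ e → μ e ≟ 1) (edges (i , i + j)))) + boundarySum edges μ (cellsFrom (suc i) hs)
boundarySum-∷ edges μ i h hs = begin
  boundarySum edges μ (columnCells i h ++ rest)
    ≡⟨ cong (length ∘ filter Q?) (concatMap-++ edges (columnCells i h) rest) ⟩
  length (filter Q? (concatMap edges (columnCells i h) ++ concatMap edges rest))
    ≡⟨ length-filter-++ Q? (concatMap edges (columnCells i h)) _ ⟩
  boundarySum edges μ (columnCells i h) + boundarySum edges μ rest
    ≡⟨ cong (_+ boundarySum edges μ rest)
         (trans (cong (boundarySum edges μ) (map-upTo (λ j → i , i + j) h))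
                (length-filter-concatMap Q? edges (λ j → i , i + j) h)) ⟩
  ∑< h (λ j → length (filter Q? (edges (i , i + j)))) + boundarySum edges μ rest ∎
  where
  rest = cellsFrom (suc i) hs
  Q? = λ e → μ e ≟ 1

length-filter₂ : ∀ {A : Set} {P : A → Set} (P? : ∀ a → Dec (P a)) a b →
  length (filter P? (a ∷ b ∷ [])) ≡ indicator (P? a) + indicator (P? b)
length-filter₂ P? a b = begin
  length (filter P? (a ∷ b ∷ []))                  ≡⟨ length-filter-∷ P? a (b ∷ []) ⟩
  indicator (P? a) + length (filter P? (b ∷ []))   ≡⟨ cong (indicator (P? a) +_) (length-filter-∷ P? b []) ⟩
  indicator (P? a) + (indicator (P? b) + 0)        ≡⟨ cong (indicator (P? a) +_) (+-identityʳ _) ⟩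
  indicator (P? a) + indicator (P? b)              ∎

-- Horizontal edges

shiftedBelow : ℕ → ℕ → ℕ
shiftedBelow zero    h = 0
shiftedBelow (suc s) h = below s h

∑<-δ-suc : ∀ s h → ∑< h (λ j → indicator (s ≟ suc j)) ≡ shiftedBelow s h
∑<-δ-suc zero    h = ∑<-0 h
∑<-δ-suc (suc s) h = ∑<-δ s h

-- The edge at offset `s` is the top of the cell at offset `s - 1`, counted by `shiftedBelow`, and
-- the bottom of the cell at offset `s`.
horizontal-column : ∀ i h s → multiplicity horizontalEdges (columnCells i h) (i , i + s) ≡ shiftedBelow s h + below s h
horizontal-column i h s = begin
  multiplicity horizontalEdges (columnCells i h) (i , i + s)
    ≡⟨ multiplicity-column horizontalEdges i h (i , i + s) ⟩
  ∑< h (λ j → indicator ((i , i + s) ∈ₑ? horizontalEdges (i , i + j)))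
    ≡⟨ ∑<-cong h (λ j _ → split j) ⟩
  ∑< h (λ j → indicator (s ≟ suc j) + indicator (s ≟ j))
    ≡⟨ ∑<-+ h _ _ ⟩
  ∑< h (λ j → indicator (s ≟ suc j)) + ∑< h (λ j → indicator (s ≟ j))
    ≡⟨ cong₂ _+_ (∑<-δ-suc s h) (∑<-δ s h) ⟩
  shiftedBelow s h + below s h ∎
  where
  split : ∀ j → indicator ((i , i + s) ∈ₑ? horizontalEdges (i , i + j)) ≡ indicator (s ≟ suc j) + indicator (s ≟ j)
  split j with s ≟ j
  ... | yes refl = trans (indicator-yes ((i , i + s) ∈ₑ? horizontalEdges (i , i + j)) (here refl))
                         (sym (cong₂ _+_ (indicator-no (s ≟ suc s) (<⇒≢ (n<1+n s))) (indicator-yes (s ≟ s) refl)))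
  ... | no s≢j = trans (indicator-⇔ ((i , i + s) ∈ₑ? horizontalEdges (i , i + j)) (s ≟ suc j) to from)
                       (sym (trans (cong (indicator (s ≟ suc j) +_) (indicator-no (s ≟ j) s≢j)) (+-identityʳ _)))
    where
    to : (i , i + s) ∈ horizontalEdges (i , i + j) → s ≡ suc j
    to (here eq)         = contradiction (+-cancelˡ-≡ i s j (cong proj₂ eq)) s≢j
    to (there (here eq)) = +-cancelˡ-≡ i s (suc j) (trans (cong proj₂ eq) (sym (+-suc i j)))
    from : s ≡ suc j → (i , i + s) ∈ horizontalEdges (i , i + j)
    from refl = there (here (cong (i ,_) (+-suc i j)))

horizontal-column-other : ∀ i h a b → a ≢ i → multiplicity horizontalEdges (columnCells i h) (a , b) ≡ 0
horizontal-column-other i h a b a≢i = multiplicity-column-0 horizontalEdges i h (a , b)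
  λ { j (here eq) → a≢i (cong proj₁ eq) ; j (there (here eq)) → a≢i (cong proj₁ eq) }

horizontal-left : ∀ i hs a b → a < i → multiplicity horizontalEdges (cellsFrom i hs) (a , b) ≡ 0
horizontal-left i []       a b a<i = refl
horizontal-left i (h ∷ hs) a b a<i = trans (multiplicity-∷ horizontalEdges i h hs (a , b))
  (cong₂ _+_ (horizontal-column-other i h a b (<⇒≢ a<i)) (horizontal-left (suc i) hs a b (m<n⇒m<1+n a<i)))

-- Distinct columns share no horizontal edge and inner edges of a column are covered twice, so each
-- column contributes its lowest and its highest edge.
horizontal-boundary : ∀ (μ : Edge → ℕ) i {hs} → All (1 ≤_) hs →
  (∀ a b → i ≤ a → μ (a , b) ≡ multiplicity horizontalEdges (cellsFrom i hs) (a , b)) →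
  boundarySum horizontalEdges μ (cellsFrom i hs) ≡ 2 * length hs
horizontal-boundary μ i [] μ≈ = refl
horizontal-boundary μ i {suc h ∷ hs} (_ ∷ hs≥1) μ≈ = begin
  boundarySum horizontalEdges μ (cellsFrom i (suc h ∷ hs))
    ≡⟨ boundarySum-∷ horizontalEdges μ i (suc h) hs ⟩
  ∑< (suc h) (λ j → length (filter (λ e → μ e ≟ 1) (horizontalEdges (i , i + j)))) + rest
    ≡⟨ cong₂ _+_ column (horizontal-boundary μ (suc i) hs≥1 μ≈′) ⟩
  2 + 2 * length hs
    ≡⟨ *-suc 2 (length hs) ⟨
  2 * suc (length hs) ∎
  where
  rest = boundarySum horizontalEdges μ (cellsFrom (suc i) hs)

  μ≈′ : ∀ a b → suc i ≤ a → μ (a , b) ≡ multiplicity horizontalEdges (cellsFrom (suc i) hs) (a , b)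
  μ≈′ a b i<a = begin
    μ (a , b) ≡⟨ μ≈ a b (<⇒≤ i<a) ⟩
    _         ≡⟨ multiplicity-∷ horizontalEdges i (suc h) hs (a , b) ⟩
    _         ≡⟨ cong (_+ multiplicity horizontalEdges (cellsFrom (suc i) hs) (a , b)) (horizontal-column-other i (suc h) a b (>⇒≢ i<a)) ⟩
    _         ∎

  μᵢ : ∀ s → μ (i , i + s) ≡ shiftedBelow s (suc h) + below s (suc h)
  μᵢ s = begin
    μ (i , i + s)                               ≡⟨ μ≈ i (i + s) ≤-refl ⟩
    _                                           ≡⟨ multiplicity-∷ horizontalEdges i (suc h) hs (i , i + s) ⟩
    _                                           ≡⟨ cong₂ _+_ (horizontal-column i (suc h) s) (horizontal-left (suc i) hs i (i + s) (n<1+n i)) ⟩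
    shiftedBelow s (suc h) + below s (suc h) + 0  ≡⟨ +-identityʳ _ ⟩
    shiftedBelow s (suc h) + below s (suc h)    ∎

  bottom top : ℕ → ℕ
  bottom j = indicator (μ (i , i + j) ≟ 1)
  top    j = indicator (μ (i , suc (i + j)) ≟ 1)

  bottom-suc : ∀ j → j < h → bottom (suc j) ≡ 0
  bottom-suc j j<h rewrite μᵢ (suc j) | below-< j<h | below-< (m<n⇒m<1+n j<h) = refl

  top≡ : ∀ j → j < suc h → top j ≡ indicator (below j h + 1 ≟ 1)
  top≡ j j<1+h rewrite sym (+-suc i j) | μᵢ (suc j) | below-< j<1+h | +-comm (below j h) 1 = refl

  column : ∑< (suc h) (λ j → length (filter (λ e → μ e ≟ 1) (horizontalEdges (i , i + j)))) ≡ 2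
  column = begin
    _ ≡⟨ ∑<-cong (suc h) (λ j _ → length-filter₂ (λ e → μ e ≟ 1) (i , i + j) (i , suc (i + j))) ⟩
    ∑< (suc h) (λ j → bottom j + top j)
      ≡⟨ ∑<-+ (suc h) bottom top ⟩
    bottom 0 + ∑< h (bottom ∘ suc) + ∑< (suc h) top
      ≡⟨ cong₂ _+_ (cong₂ _+_ (cong (λ n → indicator (n ≟ 1)) (μᵢ 0)) (trans (∑<-cong h bottom-suc) (∑<-0 h)))
                   (trans (∑<-cong (suc h) top≡) (∑<-not-below h (suc h))) ⟩
    1 + (suc h ∸ h)
      ≡⟨ cong suc (m+n∸n≡m 1 h) ⟩
    2 ∎

-- Vertical edges

vertical-∈ : ∀ a i t j → (a ≡ i ⊎ a ≡ suc i) → indicator ((a , i + t) ∈ₑ? verticalEdges (i , i + j)) ≡ indicator (t ≟ j)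
vertical-∈ a i t j a≡ = indicator-⇔ ((a , i + t) ∈ₑ? verticalEdges (i , i + j)) (t ≟ j) to (from a≡)
  where
  to : (a , i + t) ∈ verticalEdges (i , i + j) → t ≡ j
  to (here eq)         = +-cancelˡ-≡ i t j (cong proj₂ eq)
  to (there (here eq)) = +-cancelˡ-≡ i t j (cong proj₂ eq)
  from : (a ≡ i ⊎ a ≡ suc i) → t ≡ j → (a , i + t) ∈ verticalEdges (i , i + j)
  from (inj₁ refl) refl = here refl
  from (inj₂ refl) refl = there (here refl)

vertical-column : ∀ a i h t → (a ≡ i ⊎ a ≡ suc i) → multiplicity verticalEdges (columnCells i h) (a , i + t) ≡ below t h
vertical-column a i h t a≡ = begin
  multiplicity verticalEdges (columnCells i h) (a , i + t)              ≡⟨ multiplicity-column verticalEdges i h (a , i + t) ⟩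
  ∑< h (λ j → indicator ((a , i + t) ∈ₑ? verticalEdges (i , i + j)))    ≡⟨ ∑<-cong h (λ j _ → vertical-∈ a i t j a≡) ⟩
  ∑< h (λ j → indicator (t ≟ j))                                        ≡⟨ ∑<-δ t h ⟩
  below t h                                                             ∎

vertical-column-under : ∀ i h a b → b < i → multiplicity verticalEdges (columnCells i h) (a , b) ≡ 0
vertical-column-under i h a b b<i = multiplicity-column-0 verticalEdges i h (a , b)
  λ { j (here eq) → <⇒≱ b<i (above j (cong proj₂ eq)) ; j (there (here eq)) → <⇒≱ b<i (above j (cong proj₂ eq)) }
  where
  above : ∀ j → b ≡ i + j → i ≤ b
  above j refl = m≤m+n i j

vertical-column-other : ∀ i h a b → a ≢ i → a ≢ suc i → multiplicity verticalEdges (columnCells i h) (a , b) ≡ 0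
vertical-column-other i h a b a≢i a≢1+i = multiplicity-column-0 verticalEdges i h (a , b)
  λ { j (here eq) → a≢i (cong proj₁ eq) ; j (there (here eq)) → a≢1+i (cong proj₁ eq) }

vertical-left : ∀ i hs a b → a < i → multiplicity verticalEdges (cellsFrom i hs) (a , b) ≡ 0
vertical-left i []       a b a<i = refl
vertical-left i (h ∷ hs) a b a<i = trans (multiplicity-∷ verticalEdges i h hs (a , b))
  (cong₂ _+_ (vertical-column-other i h a b (<⇒≢ a<i) (<⇒≢ (m<n⇒m<1+n a<i))) (vertical-left (suc i) hs a b (m<n⇒m<1+n a<i)))

firstHeight : List ℕ → ℕ
firstHeight []      = 0
firstHeight (h ∷ _) = h

vertical-first : ∀ i hs t → multiplicity verticalEdges (cellsFrom i hs) (i , i + t) ≡ below t (firstHeight hs)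
vertical-first i []       t = refl
vertical-first i (h ∷ hs) t = begin
  multiplicity verticalEdges (cellsFrom i (h ∷ hs)) (i , i + t)
    ≡⟨ multiplicity-∷ verticalEdges i h hs (i , i + t) ⟩
  _ ≡⟨ cong₂ _+_ (vertical-column i i h t (inj₁ refl)) (vertical-left (suc i) hs i (i + t) (n<1+n i)) ⟩
  below t h + 0 ≡⟨ +-identityʳ _ ⟩
  below t h ∎

-- The lowest cell of column `i` lies under the bottom of the next column, so its right edge is
-- always on the boundary; this gives the `suc` in `descent`.
vertical-first-under : ∀ i hs → multiplicity verticalEdges (cellsFrom (suc i) hs) (suc i , i) ≡ 0
vertical-first-under i []       = refl
vertical-first-under i (h ∷ hs) = trans (multiplicity-∷ verticalEdges (suc i) h hs (suc i , i))
  (cong₂ _+_ (vertical-column-under (suc i) h (suc i) i (n<1+n i)) (vertical-left (suc (suc i)) hs (suc i) i (n<1+n (suc i))))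

-- `rise` counts left boundary edges and `descent` right ones. Since the next column starts one row
-- higher, it faces only `pred h` rows of the present one.
rise : ℕ → List ℕ → ℕ
rise d []       = 0
rise d (h ∷ hs) = (h ∸ d) + rise (pred h) hs

descent : List ℕ → ℕ
descent []       = 0
descent (h ∷ hs) = suc (pred h ∸ firstHeight hs) + descent hs

-- Here d is the number of rows ≥ i occupied by column i - 1, i.e. its height
-- minus one, or 0 if there is no such column.
vertical-boundary : ∀ (μ : Edge → ℕ) i d {hs} → All (1 ≤_) hs →
  (∀ t → μ (i , i + t) ≡ below t d + multiplicity verticalEdges (cellsFrom i hs) (i , i + t)) →
  (∀ a b → i < a → μ (a , b) ≡ multiplicity verticalEdges (cellsFrom i hs) (a , b)) →
  boundarySum verticalEdges μ (cellsFrom i hs) ≡ rise d hs + descent hs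
vertical-boundary μ i d [] μᵢ μ≈ = refl
vertical-boundary μ i d {suc h ∷ hs} (_ ∷ hs≥1) μᵢ μ≈ = begin
  boundarySum verticalEdges μ (cellsFrom i (suc h ∷ hs))
    ≡⟨ boundarySum-∷ verticalEdges μ i (suc h) hs ⟩
  _ ≡⟨ cong₂ _+_ column (vertical-boundary μ (suc i) h hs≥1 μᵢ₊₁ μ≈′) ⟩
  ((suc h ∸ d) + suc (h ∸ firstHeight hs)) + (rise h hs + descent hs)
    ≡⟨ interchange (suc h ∸ d) (suc (h ∸ firstHeight hs)) (rise h hs) (descent hs) ⟩
  ((suc h ∸ d) + rise h hs) + (suc (h ∸ firstHeight hs) + descent hs) ∎
  where
  μ-right : ∀ t → μ (suc i , i + t) ≡ below t (suc h) + multiplicity verticalEdges (cellsFrom (suc i) hs) (suc i , i + t)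
  μ-right t = begin
    μ (suc i , i + t) ≡⟨ μ≈ (suc i) (i + t) (n<1+n i) ⟩
    _                 ≡⟨ multiplicity-∷ verticalEdges i (suc h) hs (suc i , i + t) ⟩
    _                 ≡⟨ cong (_+ multiplicity verticalEdges (cellsFrom (suc i) hs) (suc i , i + t)) (vertical-column (suc i) i (suc h) t (inj₂ refl)) ⟩
    _                 ∎

  -- Offset `t` from row `i + 1` is offset `t + 1` in column `i`, which has height `suc h`; hence
  -- the next value of `d` is `h`.
  μᵢ₊₁ : ∀ t → μ (suc i , suc i + t) ≡ below t h + multiplicity verticalEdges (cellsFrom (suc i) hs) (suc i , suc i + t)
  μᵢ₊₁ t rewrite sym (+-suc i t) = μ-right (suc t)

  μ≈′ : ∀ a b → suc i < a → μ (a , b) ≡ multiplicity verticalEdges (cellsFrom (suc i) hs) (a , b)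
  μ≈′ a b 1+i<a = begin
    μ (a , b) ≡⟨ μ≈ a b (<⇒≤ 1+i<a) ⟩
    _         ≡⟨ multiplicity-∷ verticalEdges i (suc h) hs (a , b) ⟩
    _         ≡⟨ cong (_+ multiplicity verticalEdges (cellsFrom (suc i) hs) (a , b))
                      (vertical-column-other i (suc h) a b (>⇒≢ (<⇒≤ 1+i<a)) (>⇒≢ 1+i<a)) ⟩
    _         ∎

  left right : ℕ → ℕ
  left  j = indicator (μ (i , i + j) ≟ 1)
  right j = indicator (μ (suc i , i + j) ≟ 1)

  left≡ : ∀ j → j < suc h → left j ≡ indicator (below j d + 1 ≟ 1)
  left≡ j j<1+h rewrite μᵢ j | vertical-first i (suc h ∷ hs) j | below-< j<1+h = refl

  right-0 : right 0 ≡ 1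
  right-0 rewrite μ-right 0 | +-identityʳ i | vertical-first-under i hs = refl

  right-suc : ∀ j → j < h → right (suc j) ≡ indicator (below j (firstHeight hs) + 1 ≟ 1)
  right-suc j j<h
    rewrite μ-right (suc j) | +-suc i j | vertical-first (suc i) hs j | below-< j<h
          | +-comm (below j (firstHeight hs)) 1 = refl

  column : ∑< (suc h) (λ j → length (filter (λ e → μ e ≟ 1) (verticalEdges (i , i + j))))
    ≡ (suc h ∸ d) + suc (h ∸ firstHeight hs)
  column = begin
    _ ≡⟨ ∑<-cong (suc h) (λ j _ → length-filter₂ (λ e → μ e ≟ 1) (i , i + j) (suc i , i + j)) ⟩
    ∑< (suc h) (λ j → left j + right j)
      ≡⟨ ∑<-+ (suc h) left right ⟩
    ∑< (suc h) left + (right 0 + ∑< h (right ∘ suc))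
      ≡⟨ cong₂ _+_ (trans (∑<-cong (suc h) left≡) (∑<-not-below d (suc h)))
                   (cong₂ _+_ right-0 (trans (∑<-cong h right-suc) (∑<-not-below (firstHeight hs) h))) ⟩
    (suc h ∸ d) + suc (h ∸ firstHeight hs) ∎

-- The two edge counts of a polyomino

fibonacci⇒nonempty : ∀ {hs} → IsFibonacci hs → All (1 ≤_) hs
fibonacci⇒nonempty (last h≥1)  = h≥1 ∷ []
fibonacci⇒nonempty (h≥2 ∷ fib) = <⇒≤ h≥2 ∷ fibonacci⇒nonempty fib

m+[n∸m]≡n+[m∸n] : ∀ m n → m + (n ∸ m) ≡ n + (m ∸ n)
m+[n∸m]≡n+[m∸n] zero    n       = sym (trans (cong (n +_) (0∸n≡0 n)) (+-identityʳ n))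
m+[n∸m]≡n+[m∸n] (suc m) zero    = cong suc (+-identityʳ m)
m+[n∸m]≡n+[m∸n] (suc m) (suc n) = cong suc (m+[n∸m]≡n+[m∸n] m n)

-- With `suc h` and `k` the first two heights, both sides equal one plus the maximum of `h` and `k`
-- plus the rise after the second column.
descent≡rise : ∀ {hs} → All (1 ≤_) hs → descent hs ≡ rise 0 hs
descent≡rise [] = refl
descent≡rise {suc h ∷ []}      (_ ∷ []) = refl
descent≡rise {suc h ∷ k ∷ hs} (_ ∷ hs≥1) = cong suc (begin
  (h ∸ k) + descent (k ∷ hs)               ≡⟨ cong ((h ∸ k) +_) (descent≡rise hs≥1) ⟩
  (h ∸ k) + (k + rise (pred k) hs)      ≡⟨ solve 3 (λ a b c → a :+ (b :+ c) := (b :+ a) :+ c) refl (h ∸ k) k (rise (pred k) hs) ⟩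
  k + (h ∸ k) + rise (pred k) hs        ≡⟨ cong (_+ rise (pred k) hs) (m+[n∸m]≡n+[m∸n] k h) ⟩
  h + (k ∸ h) + rise (pred k) hs        ≡⟨ +-assoc h (k ∸ h) _ ⟩
  h + ((k ∸ h) + rise (pred k) hs)      ∎)

horizontalCount verticalCount : FibonacciPolyomino → ℕ
horizontalCount π = length (boundaryEdges horizontalEdges (cells π))
verticalCount   π = length (boundaryEdges verticalEdges   (cells π))

horizontalCount≡ : ∀ π → horizontalCount π ≡ 2 * length (heights π)
horizontalCount≡ π = horizontal-boundary (multiplicity horizontalEdges (cells π)) 1
  (fibonacci⇒nonempty (isFibonacci π)) (λ _ _ _ → refl)

verticalCount≡ : ∀ π → verticalCount π ≡ 2 * rise 0 (heights π)
verticalCount≡ π = begin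
  verticalCount π         ≡⟨ vertical-boundary (multiplicity verticalEdges (cells π)) 1 0 hs≥1 (λ _ → refl) (λ _ _ _ → refl) ⟩
  rise 0 hs + descent hs     ≡⟨ cong (rise 0 hs +_) (trans (descent≡rise hs≥1) (sym (+-identityʳ _))) ⟩
  2 * rise 0 hs           ∎
  where
  hs = heights π
  hs≥1 = fibonacci⇒nonempty (isFibonacci π)
-- Fibonacci polyominoes as codes

heightsOf : ∀ {m} → Code m → List ℕ
heightsOf ([]     , l) = [ suc l ]
heightsOf (v ∷ vs , l) = suc (suc v) ∷ heightsOf (vs , l)

heightsOf-isFibonacci : ∀ {m} (w : Code m) → IsFibonacci (heightsOf w)
heightsOf-isFibonacci ([]     , l) = last (s≤s z≤n)
heightsOf-isFibonacci (v ∷ vs , l) = s≤s (s≤s z≤n) ∷ heightsOf-isFibonacci (vs , l)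

length-heightsOf : ∀ {m} (w : Code m) → length (heightsOf w) ≡ suc m
length-heightsOf ([]     , l) = refl
length-heightsOf (v ∷ vs , l) = cong suc (length-heightsOf (vs , l))

encode : ∀ {hs} m → IsFibonacci hs → length hs ≡ suc m → Code m
encode zero    (last {suc l} _)            _  = [] , l
encode zero    (_ ∷ last _)                ()
encode zero    (_ ∷ (_ ∷ _))               ()
encode (suc m) (_∷_ {suc (suc v)} _ fib) eq =
  let vs , l = encode m fib (suc-injective eq) in v ∷ vs , l
encode (suc m) (_∷_ {suc zero} (s≤s ()) _) _

heightsOf-encode : ∀ {hs} m (fib : IsFibonacci hs) eq → heightsOf (encode m fib eq) ≡ hs
heightsOf-encode zero    (last {suc l} _)            _  = refl
heightsOf-encode zero    (_ ∷ last _)                ()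
heightsOf-encode zero    (_ ∷ (_ ∷ _))               ()
heightsOf-encode (suc m) (_∷_ {suc (suc v)} _ fib) eq = cong (suc (suc v) ∷_) (heightsOf-encode m fib (suc-injective eq))
heightsOf-encode (suc m) (_∷_ {suc zero} (s≤s ()) _) _

encode-heightsOf : ∀ {m} (w : Code m) eq → encode m (heightsOf-isFibonacci w) eq ≡ w
encode-heightsOf ([]     , l) eq = refl
encode-heightsOf (v ∷ vs , l) eq rewrite encode-heightsOf (vs , l) (suc-injective eq) = refl

isFibonacci-irrelevant : ∀ {hs} (p q : IsFibonacci hs) → p ≡ q
isFibonacci-irrelevant (last p) (last q) = cong last (≤-irrelevant p q)
isFibonacci-irrelevant (p ∷ ps) (q ∷ qs) = cong₂ _∷_ (≤-irrelevant p q) (isFibonacci-irrelevant ps qs)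

polyomino-≡ : ∀ {π ρ} → heights π ≡ heights ρ → π ≡ ρ
polyomino-≡ {polyomino hs p} {polyomino .hs q} refl = cong (polyomino hs) (isFibonacci-irrelevant p q)

-- A column of height `u + 2` leaves `u + 1` rows facing its successor, whence `suc u`.
rise-heightsOf : ∀ {m} u (w : Code m) → rise (suc u) (heightsOf w) ≡ cost u w
rise-heightsOf u ([]     , l) = +-identityʳ (l ∸ u)
rise-heightsOf u (v ∷ vs , l) = cong ((suc v ∸ u) +_) (rise-heightsOf v (vs , l))

-- The fictitious predecessor `u = 0` would hide one row of the first column; restoring it gives the
-- `suc`, the extra factor `y`.
rise₀-heightsOf : ∀ {m} (w : Code m) → rise 0 (heightsOf w) ≡ suc (cost 0 w)
rise₀-heightsOf ([]     , l) = cong suc (+-identityʳ l)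
rise₀-heightsOf (v ∷ vs , l) = cong (λ r → suc (suc v + r)) (rise-heightsOf v (vs , l))

fibonacciPolyominoes↔codes : ∀ m n → FibonacciPolyominoes (suc m) (suc n) ↔ (Σ[ w ∈ Code m ] cost 0 w ≡ n)
fibonacciPolyominoes↔codes m n = mk↔ₛ′ to from to∘from from∘to
 where
 len : ∀ π → HasHorizontalSemiperimeter π (suc m) → length (heights π) ≡ suc m
 len π h = *-cancelˡ-≡ _ _ 2 (trans (sym (horizontalCount≡ π)) h)
 to : FibonacciPolyominoes (suc m) (suc n) → Σ[ w ∈ Code m ] cost 0 w ≡ n
 to (π , h , v) = w , suc-injective (begin
   suc (cost 0 w)       ≡⟨ rise₀-heightsOf w ⟨
   rise 0 (heightsOf w) ≡⟨ cong (rise 0) (heightsOf-encode m (isFibonacci π) (len π h)) ⟩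
   rise 0 (heights π)   ≡⟨ *-cancelˡ-≡ _ _ 2 (trans (sym (verticalCount≡ π)) v) ⟩
   suc n ∎)
   where w = encode m (isFibonacci π) (len π h)
 from : (Σ[ w ∈ Code m ] cost 0 w ≡ n) → FibonacciPolyominoes (suc m) (suc n)
 from (w , eq) = π , trans (horizontalCount≡ π) (cong (2 *_) (length-heightsOf w))
                    , trans (verticalCount≡ π) (cong (2 *_) (trans (rise₀-heightsOf w) (cong suc eq)))
   where π = polyomino (heightsOf w) (heightsOf-isFibonacci w)
 Σ-≡ : ∀ {w w′ : Code m} {p : cost 0 w ≡ n} {p′ : cost 0 w′ ≡ n} → w ≡ w′ → (w , p) ≡ (w′ , p′)
 Σ-≡ {w} refl = cong (w ,_) (≡-irrelevant _ _)
 FP-≡ : {P Q : FibonacciPolyominoes (suc m) (suc n)} → proj₁ P ≡ proj₁ Q → P ≡ Q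
 FP-≡ {π , _} refl = cong₂ (λ h v → π , h , v) (≡-irrelevant _ _) (≡-irrelevant _ _)
 to∘from : ∀ w → to (from w) ≡ w
 to∘from (w , eq) = Σ-≡ (encode-heightsOf w _)
 from∘to : ∀ P → from (to P) ≡ P
 from∘to (π , h , v) = FP-≡ (polyomino-≡ (heightsOf-encode m (isFibonacci π) _))

-- Coefficients of power series

∑-truncate : ∀ r n f → (∀ i → f (suc r + i) ≡ 0) → ∑[0⋯ r + n ] f ≡ ∑[0⋯ r ] f
∑-truncate r zero    f f≈0 = cong (λ n → ∑[0⋯ n ] f) (+-identityʳ r)
∑-truncate r (suc n) f f≈0
  rewrite +-suc r n | f≈0 n | +-identityʳ (∑[0⋯ r + n ] f) = ∑-truncate r n f f≈0

x*ₚ-suc : ∀ g m → (x *ₚ g) (suc m) ≡ g m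
x*ₚ-suc g m = trans (∑-truncate 1 m _ (λ _ → refl)) (+-identityʳ (g m))

^ₚ-diag : ∀ k → (x ^ₚ k) k ≡ 1
^ₚ-diag zero    = refl
^ₚ-diag (suc k) = trans (x*ₚ-suc (x ^ₚ k) k) (^ₚ-diag k)

^ₚ-off : ∀ k m → k ≢ m → (x ^ₚ k) m ≡ 0
^ₚ-off zero    zero    k≢m = contradiction refl k≢m
^ₚ-off zero    (suc m) k≢m = refl
^ₚ-off (suc k) zero    k≢m = refl
^ₚ-off (suc k) (suc m) k≢m = trans (x*ₚ-suc (x ^ₚ k) m) (^ₚ-off k m (k≢m ∘ cong suc))

polynomial : ℕ → (ℕ → ℕ) → PowerSeries
polynomial n c = ∑ₚ[0⋯ n ] λ k → c k ·ₚ x ^ₚ k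

polynomial-above : ∀ n c {m} → n < m → polynomial n c m ≡ 0
polynomial-above zero    c {m} n<m = trans (cong (c 0 *_) (^ₚ-off 0 m (<⇒≢ n<m))) (*-zeroʳ (c 0))
polynomial-above (suc n) c {m} n<m =
  cong₂ _+_ (polynomial-above n c (<-trans (n<1+n n) n<m))
            (trans (cong (c (suc n) *_) (^ₚ-off (suc n) m (<⇒≢ n<m))) (*-zeroʳ (c (suc n))))

polynomial-coefficient : ∀ n c {m} → m ≤ n → polynomial n c m ≡ c m
polynomial-coefficient zero    c z≤n = *-identityʳ (c 0)
polynomial-coefficient (suc n) c {m} m≤1+n with m ≟ suc n
... | yes refl = begin
  polynomial n c (suc n) + c (suc n) * (x ^ₚ suc n) (suc n)
    ≡⟨ cong₂ _+_ (polynomial-above n c (n<1+n n)) (cong (c (suc n) *_) (^ₚ-diag (suc n))) ⟩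
  c (suc n) * 1 ≡⟨ *-identityʳ _ ⟩
  c (suc n) ∎
... | no m≢1+n = begin
  polynomial n c m + c (suc n) * (x ^ₚ suc n) m
    ≡⟨ cong₂ _+_ (polynomial-coefficient n c (≤-pred (≤∧≢⇒< m≤1+n m≢1+n))) (cong (c (suc n) *_) (^ₚ-off (suc n) m (m≢1+n ∘ sym))) ⟩
  c m + c (suc n) * 0 ≡⟨ cong (c m +_) (*-zeroʳ (c (suc n))) ⟩
  c m + 0 ≡⟨ +-identityʳ _ ⟩
  c m ∎

-- Lets the truncated sum be read as its coefficient function at every index, without comparing the
-- index with `n` each time.
polynomial-≈ : ∀ n c → (∀ k → n < k → c k ≡ 0) → polynomial n c ≈ₚ c
polynomial-≈ n c c≈0 m with m ≤? n
... | yes m≤n = polynomial-coefficient n c m≤n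
... | no  m≰n = trans (polynomial-above n c (≰⇒> m≰n)) (sym (c≈0 m (≰⇒> m≰n)))

[1+x]x-vanishes : ∀ m → ((1ₚ +ₚ x) *ₚ x) (3 + m) ≡ 0
[1+x]x-vanishes m = ∑-truncate 1 (2 + m) _ (λ _ → refl)

[1+x]x*-1 : ∀ g → ((1ₚ +ₚ x) *ₚ x *ₚ g) 1 ≡ g 0
[1+x]x*-1 g = +-identityʳ (g 0)

[1+x]x*-2+ : ∀ g m → ((1ₚ +ₚ x) *ₚ x *ₚ g) (2 + m) ≡ g (suc m) + g m
[1+x]x*-2+ g m = begin
  ((1ₚ +ₚ x) *ₚ x *ₚ g) (2 + m)
    -- `(1 + x) x` has coefficients 0, 1, 1 and then zeros; of the three remaining terms the first
    -- computes to 0.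
    ≡⟨ ∑-truncate 2 m _ (λ i → cong (_* g (2 + m ∸ (3 + i))) ([1+x]x-vanishes i)) ⟩
  g (suc m) + 0 + (g m + 0)
    ≡⟨ cong₂ _+_ (+-identityʳ (g (suc m))) (+-identityʳ (g m)) ⟩
  g (suc m) + g m ∎

-- The coefficients of the generating function

count : ℕ → ℕ → ℕ
count zero    _       = 0
count (suc m) zero    = 0
count (suc m) (suc n) = fibCount m 0 n

count-correct : CountsFibonacciPolyominoes count
count-correct (suc m) (suc n) _ _ = ↔-trans (fibonacciPolyominoes↔codes m n) (cost↔Fin m 0 n)

-- The second term is the first with `m` replaced by `suc m`, which is multiplication by `1 + x`
-- read off coefficientwise.
fibCount-formula : ∀ m n → fibCount m 0 n ≡ catalan m * compositions m n + catalan (suc m) * compositions (suc m) n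
fibCount-formula m n = trans (fibCount-split m 0 n) (cong₂ _+_ (seqCount-0 m n) (seqCount-0 (suc m) n))

count-y : [y^ 1 ] (generatingFunction count) ≈ₚ x
count-y zero          = refl
count-y (suc zero)    = refl
-- With at least two columns the cost cannot be 0: there is no composition of 0 into a positive
-- number of positive parts.
count-y (suc (suc m)) = trans (fibCount-formula (suc m) 0)
  (cong₂ _+_ (*-zeroʳ (catalan (suc m))) (*-zeroʳ (catalan (suc (suc m)))))

coefficient : ℕ → ℕ → ℕ
coefficient n k = catalan (k + 1) * (n C k)

coefficient-compositions : ∀ n k → catalan (suc k) * compositions (suc k) (suc n) ≡ coefficient n k
coefficient-compositions n k = cong₂ _*_ (cong catalan (+-comm 1 k)) (compositions-binomial k n)

polynomial-coefficient-≈ : ∀ n → polynomial n (coefficient n) ≈ₚ coefficient n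
polynomial-coefficient-≈ n = polynomial-≈ n (coefficient n) λ k n<k →
  trans (cong (catalan (k + 1) *_) (k>n⇒nCk≡0 n<k)) (*-zeroʳ (catalan (k + 1)))

count-y² : ∀ n → [y^ 2 + n ] (generatingFunction count) ≈ₚ (1ₚ +ₚ x) *ₚ x *ₚ polynomial n (coefficient n)
count-y² n zero = refl
count-y² n (suc zero) = begin
  fibCount 0 0 (suc n)                          ≡⟨ fibCount-formula 0 (suc n) ⟩
  -- The other term, `catalan 0 * compositions 0 (suc n)`, computes to 0: a single column of height
  -- 1 has cost 0.
  catalan 1 * compositions 1 (suc n)            ≡⟨ coefficient-compositions n 0 ⟩
  coefficient n 0                               ≡⟨ polynomial-coefficient-≈ n 0 ⟨
  polynomial n (coefficient n) 0                ≡⟨ [1+x]x*-1 (polynomial n (coefficient n)) ⟨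
  ((1ₚ +ₚ x) *ₚ x *ₚ polynomial n (coefficient n)) 1 ∎
count-y² n (suc (suc m)) = begin
  fibCount (suc m) 0 (suc n)
    ≡⟨ fibCount-formula (suc m) (suc n) ⟩
  _ ≡⟨ cong₂ _+_ (coefficient-compositions n m) (coefficient-compositions n (suc m)) ⟩
  coefficient n m + coefficient n (suc m)
    ≡⟨ +-comm (coefficient n m) _ ⟩
  coefficient n (suc m) + coefficient n m
    ≡⟨ cong₂ _+_ (polynomial-coefficient-≈ n (suc m)) (polynomial-coefficient-≈ n m) ⟨
  polynomial n (coefficient n) (suc m) + polynomial n (coefficient n) m
    ≡⟨ [1+x]x*-2+ (polynomial n (coefficient n)) m ⟨
  ((1ₚ +ₚ x) *ₚ x *ₚ polynomial n (coefficient n)) (2 + m) ∎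

theorem2p8 : Σ[ p ∈ (ℕ → ℕ → ℕ) ]
    CountsFibonacciPolyominoes p
    × (∀ n → n ≥ 2 →
    [y^ n ] (generatingFunction p)
    ≈ₚ (1ₚ +ₚ x) *ₚ x *ₚ ∑ₚ[0⋯ n ∸ 2 ] (λ k → (catalan (k + 1) * ((n ∸ 2) C k)) ·ₚ x ^ₚ k))
    × ([y^ 1 ] (generatingFunction p) ≈ₚ x)
theorem2p8 = count , count-correct , (λ { (suc (suc n)) _ → count-y² n ; (suc zero) (s≤s ()) }) , count-y
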